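{- Let $G$ be a connected claw-free graph of order $n\geq 4$. Then $\gamma_{cI}(G)=n/2$ if and only if $G\in\Omega$.
   Context: All graphs are finite and simple; $G$ is claw-free if it has no induced subgraph isomorphic to $K_{1,3}$. A function $f:V(G)\to\{0,1,2\}$ is a covering Italian dominating function (CID function) of $G$ if (i) for every vertex $v$ with $f(v)=0$ we have $\sum_{u\in N(v)} f(u)\geq 2$, where $N(v)$ is the open neighborhood of $v$, and (ii) the set $\{v: f(v)=0\}$ is independent. $\gamma_{cI}(G)$ is the minimum of $\sum_v f(v)$ over all CID functions $f$ of $G$. For $k\geq 1$, a $k$-triangle is the graph with vertices $v_1,\dots,v_k,u_1,\dots,u_{k-1}$ and edges $v_iv_{i+1}$, $u_iv_i$, $u_iv_{i+1}$ for $1\leq i\leq k-1$ (so it consists of $k-1$ triangles glued in a chain; a $1$-triangle is a single vertex); its end vertices are $v_1$ and $v_k$. For integers $r\geq 1$ and $k_1,\dots,k_r\geq 1$ (with $k_1\geq 2$ if $r=1$), the graph $G(k_1,\dots,k_r)$ is obtained from disjoint copies $T_1,\dots,T_r$, where $T_i$ is a $k_i$-triangle with end vertices $a_i$ (its $v_1$) and $b_i$ (its $v_{k_i}$), by adding $r$ new vertices $w_1,\dots,w_r$ with $w_i$ adjacent exactly to $b_i$ and $a_{i+1}$ (indices modulo $r$, so $w_r$ is adjacent to $b_r$ and $a_1$). For $k\geq 3$, the $k$-sun on a cycle is the graph obtained from a cycle $v_1v_2\cdots v_kv_1$ by adding $k$ new vertices $u_1,\dots,u_k$ with $u_i$ adjacent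 exactly to $v_i$ and $v_{i+1}$ (where $v_{k+1}=v_1$). $\Omega$ is the family of graphs that are either a $k$-sun on a cycle, or of the form $G(k_1,\dots,k_r)$. -}

module Defs where

open import Data.Nat using (ℕ; zero; suc; _+_; _*_; _∸_; _≤_)
open import Data.Fin using (Fin; toℕ)
open import Data.Bool using (Bool; true; false; if_then_else_)
open import Data.List using (List; map; allFin)
open import Data.Nat.ListAction using (sum)
open import Data.Product using (Σ; _×_; _,_; ∃)
open import Data.Sum using (_⊎_; inj₁; inj₂)
open import Data.Unit using (⊤)
open import Data.Empty using (⊥)
open import Relation.Nullary using (¬_)
open import Relation.Binary.PropositionalEquality using (_≡_)
open import Function.Bundles using (_↔_; Inverse)

record Graph (n : ℕ) : Set where
  field
    adj     : Fin n → Fin n → Bool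
    symm    : ∀ x y → adj x y ≡ adj y x
    irrefl  : ∀ x → adj x x ≡ false
open Graph public

Adj : ∀ {n} → Graph n → Fin n → Fin n → Set
Adj G x y = adj G x y ≡ true

data Reach {n : ℕ} (G : Graph n) : Fin n → Fin n → Set where
  here : ∀ {x} → Reach G x x
  step : ∀ {x y z} → Adj G x y → Reach G y z → Reach G x z

Connected : ∀ {n} → Graph n → Set
Connected G = ∀ x y → Reach G x y

ClawFree : ∀ {n} → Graph n → Set
ClawFree G = ∀ c x y z →
  Adj G c x → Adj G c y → Adj G c z →
  ¬ (x ≡ y) → ¬ (x ≡ z) → ¬ (y ≡ z) →
  ¬ (adj G x y ≡ false × adj G x z ≡ false × adj G y z ≡ false)

weight : ∀ {n} → (Fin n → ℕ) → ℕ
weight {n} f = sum (map f (allFin n))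

nbrSum : ∀ {n} → Graph n → (Fin n → ℕ) → Fin n → ℕ
nbrSum {n} G f v = sum (map (λ u → if adj G v u then f u else 0) (allFin n))

IsCID : ∀ {n} → Graph n → (Fin n → ℕ) → Set
IsCID G f =
  (∀ v → f v ≤ 2) ×
  (∀ v → f v ≡ 0 → 2 ≤ nbrSum G f v) ×
  (∀ u v → f u ≡ 0 → f v ≡ 0 → adj G u v ≡ false)

IsGammaCI : ∀ {n} → Graph n → ℕ → Set
IsGammaCI G m =
  (Σ _ λ f → IsCID G f × weight f ≡ m) ×
  (∀ f → IsCID G f → m ≤ weight f)

CycSucc : (k : ℕ) → Fin k → Fin k → Set
CycSucc k i j = (toℕ j ≡ suc (toℕ i)) ⊎ (suc (toℕ i) ≡ k × toℕ j ≡ 0)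

-- k-sun on a cycle: inj₁ i = v_i (cycle), inj₂ i = u_i (adjacent to v_i, v_{i+1})
SunV : ℕ → Set
SunV k = Fin k ⊎ Fin k

SunEdge : (k : ℕ) → SunV k → SunV k → Set
SunEdge k (inj₁ i) (inj₁ j) = CycSucc k i j
SunEdge k (inj₂ i) (inj₁ j) = (i ≡ j) ⊎ CycSucc k i j
SunEdge k _        _        = ⊥

-- G(k_1,...,k_r): block i consists of
--   tri-v a   : v_{a+1} of the k_i-triangle T_i  (a < k_i)
--   tri-u a   : u_{a+1} of T_i                    (a < k_i - 1)
--   con       : the vertex w_i
data BlockV (k : ℕ) : Set where
  tri-v : Fin k → BlockV k
  tri-u : Fin (k ∸ 1) → BlockV k
  con   : BlockV k

GV : (r : ℕ) → (Fin r → ℕ) → Set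
GV r ks = Σ (Fin r) λ i → BlockV (ks i)

GEdge : (r : ℕ) (ks : Fin r → ℕ) → GV r ks → GV r ks → Set
GEdge r ks (i , tri-v a) (j , tri-v b) = (i ≡ j) × (toℕ b ≡ suc (toℕ a))
GEdge r ks (i , tri-u a) (j , tri-v b) =
  (i ≡ j) × ((toℕ b ≡ toℕ a) ⊎ (toℕ b ≡ suc (toℕ a)))
-- w_i b_i  and  w_i a_{i+1}  (indices mod r)
GEdge r ks (i , con) (j , tri-v b) =
  ((i ≡ j) × (suc (toℕ b) ≡ ks i)) ⊎ (CycSucc r i j × toℕ b ≡ 0)
GEdge r ks _ _ = ⊥

Sym : ∀ {V : Set} → (V → V → Set) → V → V → Set
Sym E x y = E x y ⊎ E y x

-- G is isomorphic to the graph (V, E) (E given as a directed edge relation,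
-- adjacency is its symmetric closure)
IsoTo : ∀ {n} → Graph n → (V : Set) → (V → V → Set) → Set
IsoTo {n} G V E =
  Σ (Fin n ↔ V) λ σ →
    ∀ x y → (Adj G x y → Sym E (Inverse.to σ x) (Inverse.to σ y)) ×
            (Sym E (Inverse.to σ x) (Inverse.to σ y) → Adj G x y)

InΩ : ∀ {n} → Graph n → Set
InΩ G =
  (Σ ℕ λ k → 3 ≤ k × IsoTo G (SunV k) (SunEdge k))
  ⊎
  (Σ ℕ λ r → Σ (Fin r → ℕ) λ ks →
     1 ≤ r × (∀ i → 1 ≤ ks i) × (∀ i → r ≡ 1 → 2 ≤ ks i) ×
     IsoTo G (GV r ks) (GEdge r ks))

{-# OPTIONS --safe #-}
-- Let Z be the zero set of a CID function f. It is independent, so in a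
-- claw-free graph every vertex has at most two neighbours in Z, whereas every
-- vertex of Z sees weight at least 2; hence 2|Z| ≤ 2 w(f), and with
-- n ≤ |Z| + w(f) this gives n ≤ 2 w(f). If n = 2 w(f), all these estimates are
-- tight: f is 0/1-valued and the edges between the classes f = 0 and f = 1 form
-- a 2-regular graph. Any further edge joins two vertices of the class f = 1 and,
-- by claw-freeness, closes a triangle with a common neighbour in Z. By
-- connectivity the 2-regular graph is a single cycle v₀ u₀ v₁ u₁ …, so G consists
-- of this cycle together with some of the chords vᵢvᵢ₊₁. With all chords present
-- it is a sun (or, for n = 4, G(2)); otherwise cutting at the missing chords
-- yields the blocks of G(k₁,…,kᵣ). Conversely, the indicator function of the vᵢ
-- is a CID function of weight n/2.
module Submission where

open import Defs
open import Data.Bool using (Bool; true; false; if_then_else_; not)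
open import Data.Bool.Properties as Bool using (not-involutive; not-¬)
open import Data.Empty using (⊥; ⊥-elim)
open import Data.Fin using (Fin; zero; suc; toℕ; fromℕ; fromℕ<; inject₁; splitAt; _↑ˡ_; _↑ʳ_; _≟_)
open import Data.Fin.Properties using (suc-injective; 0≢1+n; pigeonhole; toℕ-injective; toℕ-fromℕ; toℕ<n; toℕ-fromℕ<; toℕ-inject₁; toℕ-↑ˡ; toℕ-↑ʳ; splitAt-↑ˡ; splitAt-↑ʳ; join-splitAt; all?; ¬∀⟶∃¬)
open import Data.Fin.Relation.Unary.Top using (view; ‵fromℕ; ‵inject₁; view-fromℕ; view-inject₁)
open import Data.List using (tabulate)
open import Data.List.Properties using (map-tabulate)
open import Data.Nat using (ℕ; zero; suc; _+_; _*_; _∸_; _≤_; _<_; _<ᵇ_; z≤n; s≤s)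
import Data.Nat.ListAction as List
open import Data.Nat.Properties as ℕ hiding (suc-injective; 0≢1+n; _≟_)
open import Data.Product using (Σ; ∃; _×_; _,_; proj₁; proj₂)
open import Data.Sum as Sum using (_⊎_; inj₁; inj₂; [_,_]; swap)
open import Data.Sum.Properties using (swap-involutive; inj₁-injective)
open import Data.Vec.Functional using (_∷_)
open import Function using (_∘_; id)
open import Function.Bundles using (_↔_; _⇔_; Inverse; Equivalence; mk↔ₛ′; mk⇔)
open import Function.Construct.Identity using (↔-id)
open import Function.Properties.Inverse using (↔-trans; ↔-sym)
open import Relation.Binary using (tri<; tri≈; tri>)
open import Relation.Binary.PropositionalEquality using (_≡_; _≢_; refl; sym; trans; cong; cong₂; subst; subst₂; module ≡-Reasoning)
open import Relation.Nullary using (¬_; yes; no; contradiction)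
open import Relation.Nullary.Decidable using (_→-dec_)
open import Relation.Unary using (Decidable)
open import Algebra.Properties.Semiring.Sum +-*-semiring
open Inverse using (to; from; strictlyInverseˡ)

-- Finite sums and functions with values 0 and 1.

weight≡sum : ∀ {n} (f : Fin n → ℕ) → weight f ≡ sum f
weight≡sum {n} f = trans (cong List.sum (map-tabulate {n = n} id f)) (sum-tabulate f)
  where
  sum-tabulate : ∀ {n} (g : Fin n → ℕ) → List.sum (tabulate g) ≡ sum g
  sum-tabulate {zero}  g = refl
  sum-tabulate {suc n} g = cong (g zero +_) (sum-tabulate (g ∘ suc))

sum-mono : ∀ {n} {f g : Fin n → ℕ} → (∀ x → f x ≤ g x) → sum f ≤ sum g
sum-mono {zero}  f≤g = z≤n
sum-mono {suc n} f≤g = +-mono-≤ (f≤g zero) (sum-mono (f≤g ∘ suc))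

-- The tails are already ordered, so cancelling them from the reversed inequality of sums reverses
-- the inequality of heads, and vice versa.
sum-tight : ∀ {n} {f g : Fin n → ℕ} → (∀ x → f x ≤ g x) → sum g ≤ sum f → ∀ x → f x ≡ g x
sum-tight {suc n} {f} {g} f≤g Σg≤Σf zero = ≤-antisym (f≤g zero)
  (+-cancelʳ-≤ (sum (f ∘ suc)) (g zero) (f zero)
    (≤-trans (+-monoʳ-≤ (g zero) (sum-mono (f≤g ∘ suc))) Σg≤Σf))
sum-tight {suc n} {f} {g} f≤g Σg≤Σf (suc x) = sum-tight (f≤g ∘ suc)
  (+-cancelˡ-≤ (g zero) _ _ (≤-trans Σg≤Σf (+-monoˡ-≤ _ (f≤g zero)))) x

sum-const-1 : ∀ n → sum {n} (λ _ → 1) ≡ n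
sum-const-1 zero    = refl
sum-const-1 (suc n) = cong suc (sum-const-1 n)

term≤sum : ∀ {n} (f : Fin n → ℕ) x → f x ≤ sum f
term≤sum f zero    = m≤m+n _ _
term≤sum f (suc x) = ≤-trans (term≤sum (f ∘ suc) x) (m≤n+m _ _)

two-terms≤sum : ∀ {n} (f : Fin n → ℕ) {x y} → x ≢ y → f x + f y ≤ sum f
two-terms≤sum f {zero}  {zero}  x≢y = contradiction refl x≢y
two-terms≤sum f {zero}  {suc y} x≢y = +-monoʳ-≤ (f zero) (term≤sum (f ∘ suc) y)
two-terms≤sum f {suc x} {zero}  x≢y =
  ≤-trans (≤-reflexive (+-comm (f (suc x)) _)) (+-monoʳ-≤ (f zero) (term≤sum (f ∘ suc) x))
two-terms≤sum f {suc x} {suc y} x≢y =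
  ≤-trans (two-terms≤sum (f ∘ suc) (x≢y ∘ cong suc)) (m≤n+m _ _)

-- Turns a numerical count into actual vertices: when `h` is 0/1-valued and `m` is its sum, the
-- support of `h` is listed without repetition.
record Enumeration {n : ℕ} (m : ℕ) (h : Fin n → ℕ) : Set where
  field
    enum     : Fin m → Fin n
    enum-inj : ∀ {i j} → enum i ≡ enum j → i ≡ j
    enum-one : ∀ i → h (enum i) ≡ 1
    enum-all : ∀ x → h x ≡ 1 → ∃ λ i → x ≡ enum i
open Enumeration

enumerate : ∀ {n} (h : Fin n → ℕ) → (∀ x → h x ≤ 1) → Enumeration (sum h) h
enumerate {zero}  h h≤1 = record
  { enum = λ () ; enum-inj = λ {} ; enum-one = λ () ; enum-all = λ () }
enumerate {suc n} h h≤1 with h zero in eq | h≤1 zero | enumerate (h ∘ suc) (h≤1 ∘ suc)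
... | zero  | _         | E = record
  { enum     = suc ∘ enum E
  ; enum-inj = enum-inj E ∘ suc-injective
  ; enum-one = enum-one E
  ; enum-all = λ { zero h0≡1 → contradiction (trans (sym eq) h0≡1) λ ()
                 ; (suc x) hx≡1 → let i , x≡ = enum-all E x hx≡1 in i , cong suc x≡ } }
... | suc zero | _ | E = record
  { enum     = λ { zero → zero ; (suc i) → suc (enum E i) }
  ; enum-inj = λ { {zero} {zero} _ → refl
                 ; {suc i} {suc j} p → cong suc (enum-inj E (suc-injective p)) }
  ; enum-one = λ { zero → eq ; (suc i) → enum-one E i }
  ; enum-all = λ { zero _ → zero , refl
                 ; (suc x) hx≡1 → let i , x≡ = enum-all E x hx≡1 in suc i , cong suc x≡ } }
... | suc (suc _) | s≤s () | _

record Pair {n : ℕ} (P : Fin n → Set) : Set where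
  field
    fst snd : Fin n
    fst≢snd : fst ≢ snd
    P-fst   : P fst
    P-snd   : P snd
    only    : ∀ x → P x → x ≡ fst ⊎ x ≡ snd

two-ones : ∀ {n} (h : Fin n → ℕ) → (∀ x → h x ≤ 1) → sum h ≡ 2 → Pair (λ x → h x ≡ 1)
two-ones h h≤1 Σh≡2 with sum h | Σh≡2 | enumerate h h≤1
... | _ | refl | E = record
  { fst = enum E zero ; snd = enum E (suc zero)
  ; fst≢snd = 0≢1+n ∘ enum-inj E
  ; P-fst = enum-one E zero ; P-snd = enum-one E (suc zero)
  ; only = λ x hx → case (enum-all E x hx) }
  where
  case : ∀ {x} → (∃ λ i → x ≡ enum E i) → x ≡ enum E zero ⊎ x ≡ enum E (suc zero)
  case (zero , p)     = inj₁ p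
  case (suc zero , p) = inj₂ p

-- Double counting between the zero set and the weight.

isZero : ℕ → ℕ
isZero zero    = 1
isZero (suc _) = 0

isZero≤1 : ∀ a → isZero a ≤ 1
isZero≤1 zero    = s≤s z≤n
isZero≤1 (suc _) = z≤n

isZero≡1 : ∀ {a} → isZero a ≡ 1 → a ≡ 0
isZero≡1 {zero} _ = refl

mask : Bool → ℕ → ℕ
mask b a = if b then a else 0

mask≤1 : ∀ b {a} → a ≤ 1 → mask b a ≤ 1
mask≤1 true  a≤1 = a≤1
mask≤1 false _   = z≤n

mask≡1 : ∀ b {a} → mask b a ≡ 1 → b ≡ true × a ≡ 1
mask≡1 true p = refl , p

mask-true : ∀ {b} a → b ≡ true → mask b a ≡ a
mask-true a refl = refl

module _ {n : ℕ} (G : Graph n) where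

  nbrSum≡sum : ∀ f v → nbrSum G f v ≡ sum (λ u → mask (adj G v u) (f u))
  nbrSum≡sum f v = weight≡sum (λ u → mask (adj G v u) (f u))

  -- Both sides add `g v * f u` over the ordered adjacent pairs; the order of summation is exchanged
  -- and adjacency is symmetric.
  double-count : ∀ (f g : Fin n → ℕ) →
    sum (λ v → g v * nbrSum G f v) ≡ sum (λ u → f u * nbrSum G g u)
  double-count f g = begin
    sum (λ v → g v * nbrSum G f v)                        ≡⟨ sum-cong-≗ (expand g f) ⟩
    sum (λ v → sum (λ u → g v * mask (adj G v u) (f u)))  ≡⟨ ∑-comm (λ v u → g v * mask (adj G v u) (f u)) ⟩
    sum (λ u → sum (λ v → g v * mask (adj G v u) (f u)))  ≡⟨ sum-cong-≗ (λ u → sum-cong-≗ (exchange u)) ⟩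
    sum (λ u → sum (λ v → f u * mask (adj G u v) (g v)))  ≡⟨ sum-cong-≗ (expand f g) ⟨
    sum (λ u → f u * nbrSum G g u)                        ∎
    where
    open ≡-Reasoning
    expand : ∀ (a b : Fin n → ℕ) v → a v * nbrSum G b v ≡ sum (λ u → a v * mask (adj G v u) (b u))
    expand a b v = trans (cong (a v *_) (nbrSum≡sum b v)) (*-distribˡ-sum (a v) (λ u → mask (adj G v u) (b u)))
    exchange : ∀ u v → g v * mask (adj G v u) (f u) ≡ f u * mask (adj G u v) (g v)
    exchange u v rewrite symm G v u with adj G u v
    ... | true  = *-comm (g v) (f u)
    ... | false = trans (*-zeroʳ (g v)) (sym (*-zeroʳ (f u)))

module Counting {n : ℕ} (G : Graph n) (claw : ClawFree G)
                (f : Fin n → ℕ) (cid : IsCID G f) where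

  z : Fin n → ℕ
  z v = isZero (f v)

  indep : ∀ u v → f u ≡ 0 → f v ≡ 0 → adj G u v ≡ false
  indep = proj₂ (proj₂ cid)

  zero-nbr≤1 : ∀ u v → mask (adj G u v) (z v) ≤ 1
  zero-nbr≤1 u v = mask≤1 (adj G u v) (isZero≤1 (f v))

  -- Zeros of `f` are pairwise non-adjacent, so three of them around `u` would be the leaves of a
  -- claw.
  zero-degree≤2 : ∀ u → nbrSum G z u ≤ 2
  zero-degree≤2 u rewrite nbrSum≡sum G z u
    with sum (λ v → mask (adj G u v) (z v)) | enumerate _ (zero-nbr≤1 u)
  ... | zero            | _ = z≤n
  ... | suc zero        | _ = s≤s z≤n
  ... | suc (suc zero)  | _ = s≤s (s≤s z≤n)
  ... | suc (suc (suc m)) | E = ⊥-elim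
    (claw u (e zero) (e (suc zero)) (e (suc (suc zero)))
      (proj₁ (z-nbr zero)) (proj₁ (z-nbr (suc zero))) (proj₁ (z-nbr (suc (suc zero))))
      ((λ ()) ∘ enum-inj E) ((λ ()) ∘ enum-inj E) ((λ ()) ∘ enum-inj E)
      (ind zero (suc zero) , ind zero (suc (suc zero)) , ind (suc zero) (suc (suc zero))))
    where
    e = enum E
    z-nbr : ∀ i → adj G u (e i) ≡ true × z (e i) ≡ 1
    z-nbr i = mask≡1 (adj G u (e i)) (enum-one E i)
    ind : ∀ i j → adj G (e i) (e j) ≡ false
    ind i j = indep (e i) (e j) (isZero≡1 (proj₂ (z-nbr i))) (isZero≡1 (proj₂ (z-nbr j)))

  dominated : ∀ v → z v * 2 ≤ z v * nbrSum G f v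
  dominated v with f v in eq
  -- The factor `1` unfolds to an added `0` on either side.
  ... | zero  = +-monoˡ-≤ 0 (proj₁ (proj₂ cid) v eq)
  ... | suc _ = z≤n

  covered : ∀ v → 1 ≤ z v + f v
  covered v with f v
  ... | zero  = s≤s z≤n
  ... | suc _ = s≤s z≤n

  zeros*2≤ : sum (λ v → z v * nbrSum G f v) ≤ sum f * 2
  zeros*2≤ = begin
    sum (λ v → z v * nbrSum G f v)  ≡⟨ double-count G f z ⟩
    sum (λ u → f u * nbrSum G z u)  ≤⟨ sum-mono (λ u → *-monoʳ-≤ (f u) (zero-degree≤2 u)) ⟩
    sum (λ u → f u * 2)             ≡⟨ *-distribʳ-sum 2 f ⟨
    sum f * 2                       ∎
    where open ≤-Reasoning

  Σz*2≤ : sum z * 2 ≤ sum (λ v → z v * nbrSum G f v)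
  Σz*2≤ = ≤-trans (≤-reflexive (*-distribʳ-sum 2 z)) (sum-mono dominated)

  Σz≤Σf : sum z ≤ sum f
  Σz≤Σf = *-cancelʳ-≤ (sum z) (sum f) 2 (≤-trans Σz*2≤ zeros*2≤)

  n≤Σz+Σf : n ≤ sum z + sum f
  n≤Σz+Σf = begin
    n                      ≡⟨ sum-const-1 n ⟨
    sum {n} (λ _ → 1)      ≤⟨ sum-mono covered ⟩
    sum (λ v → z v + f v)  ≡⟨ ∑-distrib-+ z f ⟩
    sum z + sum f          ∎
    where open ≤-Reasoning

  n≤2weight : n ≤ 2 * weight f
  n≤2weight = begin
    n              ≤⟨ n≤Σz+Σf ⟩
    sum z + sum f  ≤⟨ +-monoˡ-≤ (sum f) Σz≤Σf ⟩
    sum f + sum f  ≡⟨ cong (sum f +_) (+-identityʳ (sum f)) ⟨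
    2 * sum f      ≡⟨ cong (2 *_) (weight≡sum f) ⟨
    2 * weight f   ∎
    where open ≤-Reasoning

  module Tight (2w≡n : 2 * weight f ≡ n) where

    Σf+Σf≡n : sum f + sum f ≡ n
    Σf+Σf≡n = trans (cong (sum f +_) (sym (+-identityʳ (sum f))))
                    (trans (cong (2 *_) (sym (weight≡sum f))) 2w≡n)

    -- With this the chain from `sum z * 2` to `sum f * 2` closes up, so `sum-tight` applies to each
    -- of its links.
    Σf≤Σz : sum f ≤ sum z
    Σf≤Σz = +-cancelʳ-≤ (sum f) (sum f) (sum z) (≤-trans (≤-reflexive Σf+Σf≡n) n≤Σz+Σf)

    z+f≡1 : ∀ v → z v + f v ≡ 1
    z+f≡1 v = sym (sum-tight covered
      (≤-trans (≤-reflexive (∑-distrib-+ z f))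
        (≤-trans (+-monoˡ-≤ (sum f) Σz≤Σf)
          (≤-reflexive (trans Σf+Σf≡n (sym (sum-const-1 n)))))) v)

    zero-nbrSum : ∀ v → f v ≡ 0 → nbrSum G f v ≡ 2
    zero-nbrSum v fv≡0 = sym (trans (sym (*-identityˡ 2)) (trans (eq (cong isZero fv≡0)) (*-identityˡ _)))
      where
      tight : z v * 2 ≡ z v * nbrSum G f v
      tight = sum-tight dominated
        (≤-trans zeros*2≤ (≤-trans (*-monoˡ-≤ 2 Σf≤Σz) (≤-reflexive (*-distribʳ-sum 2 z)))) v
      -- The factor `z v` is abstracted so that its value `1` can be put in its place.
      eq : ∀ {a} → z v ≡ a → a * 2 ≡ a * nbrSum G f v
      eq refl = tight

    one-nbrSum : ∀ u → f u ≡ 1 → nbrSum G z u ≡ 2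
    one-nbrSum u fu≡1 = trans (sym (*-identityˡ _)) (trans (eq fu≡1) (*-identityˡ 2))
      where
      tight : f u * nbrSum G z u ≡ f u * 2
      tight = sum-tight (λ u → *-monoʳ-≤ (f u) (zero-degree≤2 u))
        (≤-trans (≤-reflexive (sym (*-distribʳ-sum 2 f)))
          (≤-trans (*-monoˡ-≤ 2 Σf≤Σz) (≤-trans Σz*2≤ (≤-reflexive (double-count G f z))))) u
      eq : ∀ {a} → f u ≡ a → a * nbrSum G z u ≡ a * 2
      eq refl = tight

    f≤1 : ∀ v → f v ≤ 1
    f≤1 v = ≤-trans (m≤n+m (f v) (z v)) (≤-reflexive (z+f≡1 v))

-- Suns with optional chords, and cyclic successors.

-- The common normal form of both families in Ω: a cycle v₀ u₀ v₁ u₁ ... in which the chord from vᵢ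
-- to its successor is an edge where `e i` is true.
OptEdge : (k : ℕ) → (Fin k → Bool) → SunV k → SunV k → Set
OptEdge k e (inj₁ i) (inj₁ j) = CycSucc k i j × e i ≡ true
OptEdge k e (inj₂ i) (inj₁ j) = (i ≡ j) ⊎ CycSucc k i j
OptEdge k e _        _        = ⊥

cycSucc-functional : ∀ {k} {i j l : Fin k} → CycSucc k i j → CycSucc k i l → j ≡ l
cycSucc-functional (inj₁ p)       (inj₁ q)       = toℕ-injective (trans p (sym q))
cycSucc-functional {j = j} (inj₁ p) (inj₂ (q , _)) = contradiction (trans p q) (<⇒≢ (toℕ<n j))
cycSucc-functional {l = l} (inj₂ (p , _)) (inj₁ q) = contradiction (trans q p) (<⇒≢ (toℕ<n l))
cycSucc-functional (inj₂ (_ , p)) (inj₂ (_ , q)) = toℕ-injective (trans p (sym q))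

cycSucc-exists : ∀ {k} (i : Fin k) → ∃ (CycSucc k i)
cycSucc-exists {suc k} i with suc (toℕ i) ℕ.≟ suc k
... | no 1+i≢k  = let 1+i<k = ≤∧≢⇒< (toℕ<n i) 1+i≢k in fromℕ< 1+i<k , inj₁ (toℕ-fromℕ< 1+i<k)
... | yes 1+i≡k = zero , inj₂ (1+i≡k , refl)

cycPred-exists : ∀ {k} (j : Fin k) → ∃ λ i → CycSucc k i j
cycPred-exists {suc k} zero    = fromℕ k , inj₂ (cong suc (toℕ-fromℕ k) , refl)
cycPred-exists {suc k} (suc j) = inject₁ j , inj₁ (cong suc (sym (toℕ-inject₁ j)))

least : ∀ {P : ℕ → Set} → Decidable P → ∀ b → P b → ∃ λ a → P a × (∀ {c} → c < a → ¬ P c)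
least P? zero    Pb = zero , Pb , λ ()
least {P} P? (suc b) Pb with P? zero
... | yes P0 = zero , P0 , λ ()
... | no ¬P0 with least (P? ∘ suc) b Pb
...   | a , Pa , min = suc a , Pa , λ { {zero} _ → ¬P0 ; {suc c} (s≤s c<a) → min c<a }

-- The backward implication is asked only for directed edges; symmetry of `G` supplies the other
-- orientation.
bijective⇒iso : ∀ {n} (G : Graph n) {V : Set} {E : V → V → Set} (g : V → Fin n) →
  (∀ {x y} → g x ≡ g y → x ≡ y) → (∀ y → ∃ λ x → g x ≡ y) →
  (∀ x y → (Adj G (g x) (g y) → Sym E x y) × (E x y → Adj G (g x) (g y))) →
  IsoTo G V E
bijective⇒iso G {E = E} g inj surj adj⇔ =
  mk↔ₛ′ h g (λ x → inj (gh (g x))) gh ,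
  λ x y → (λ a → proj₁ (adj⇔ (h x) (h y)) (subst₂ (Adj G) (sym (gh x)) (sym (gh y)) a)) ,
          λ e → subst₂ (Adj G) (gh x) (gh y) (back e)
  where
  h  = proj₁ ∘ surj
  gh = proj₂ ∘ surj
  back : ∀ {x y} → Sym E x y → Adj G (g x) (g y)
  back {x} {y} (inj₁ e) = proj₂ (adj⇔ x y) e
  back {x} {y} (inj₂ e) = trans (symm G (g x) (g y)) (proj₂ (adj⇔ y x) e)

-- Walking along the 2-regular graph between the colour classes.

record Cross {n : ℕ} (G : Graph n) (colour : Fin n → Bool) (x y : Fin n) : Set where
  constructor cross
  field
    edge   : Adj G x y
    switch : colour y ≡ not (colour x)
open Cross

-- What a tight CID function f leaves behind; colour x is true iff f x ≠ 0.
record AlternatingCycles {n : ℕ} (G : Graph n) : Set where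
  field
    colour  : Fin n → Bool
    nbrs    : ∀ x → Pair (Cross G colour x)
    indep   : ∀ {x y} → Adj G x y → colour x ≡ false → colour y ≡ true
    linked  : ∀ {x y} → Adj G x y → colour x ≡ true → colour y ≡ true →
              ∃ λ w → colour w ≡ false × Adj G x w × Adj G w y

module Walk {n : ℕ} (G : Graph n) (conn : Connected G) (A : AlternatingCycles G) where
  open AlternatingCycles A

  H : Fin n → Fin n → Set
  H = Cross G colour

  adj-sym : ∀ {x y} → Adj G x y → Adj G y x
  adj-sym {x} {y} a = trans (symm G y x) a

  H-sym : ∀ {x y} → H x y → H y x
  H-sym (cross a c) = cross (adj-sym a) (trans (sym (not-involutive _)) (cong not (sym c)))

  module N x = Pair (nbrs x)

  -- For `w` of colour `false` this tells whether the chord over `w` is present.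
  link : Fin n → Bool
  link w = adj G (N.fst w) (N.snd w)

  -- Outside this block only the properties of `other` are used, so its case split stays folded.
  abstract

    -- Meant for an `H`-neighbour `y` of `x`. Any other `y` gets the default `N.fst x`, so `H-other`
    -- and `other≢` hold without a condition on `y`.
    other : Fin n → Fin n → Fin n
    other x y with y ≟ N.fst x
    ... | yes _ = N.snd x
    ... | no  _ = N.fst x

    H-other : ∀ x y → H x (other x y)
    H-other x y with y ≟ N.fst x
    ... | yes _ = N.P-snd x
    ... | no  _ = N.P-fst x

    other≢ : ∀ x y → other x y ≢ y
    other≢ x y with y ≟ N.fst x
    ... | yes y≡ = λ s≡y → N.fst≢snd x (trans (sym y≡) (sym s≡y))
    ... | no  y≢ = y≢ ∘ sym

    nbr-cases : ∀ {x y z} → H x y → H x z → z ≡ y ⊎ z ≡ other x y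
    nbr-cases {x} {y} {z} hy hz with y ≟ N.fst x | N.only x y hy | N.only x z hz
    ... | yes y≡ | _       | inj₁ z≡ = inj₁ (trans z≡ (sym y≡))
    ... | yes _  | _       | inj₂ z≡ = inj₂ z≡
    ... | no y≢  | inj₁ y≡ | _       = contradiction y≡ y≢
    ... | no _   | inj₂ _  | inj₁ z≡ = inj₂ z≡
    ... | no _   | inj₂ y≡ | inj₂ z≡ = inj₁ (trans z≡ (sym y≡))

    adj-other : ∀ {w x} → H w x → adj G x (other w x) ≡ link w
    adj-other {w} {x} hx with x ≟ N.fst w | N.only w x hx
    ... | yes refl | _         = refl
    ... | no x≢    | inj₁ x≡   = contradiction x≡ x≢
    ... | no _     | inj₂ refl = symm G _ _

  other-unique : ∀ {x y z} → H x y → H x z → z ≢ y → z ≡ other x y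
  other-unique hy hz z≢y = [ (λ z≡y → contradiction z≡y z≢y) , id ] (nbr-cases hy hz)

  module From (w₀ : Fin n) (w₀-false : colour w₀ ≡ false) where

    -- The walk starts next to `w₀` and heads away from it, so that `w₀` is the vertex through which
    -- the cycle finally closes.
    s : ℕ → Fin n
    s 0             = N.fst w₀
    s 1             = other (N.fst w₀) w₀
    s (suc (suc i)) = other (s (suc i)) (s i)

    s-H : ∀ i → H (s i) (s (suc i))
    s-H 0       = H-other _ _
    s-H (suc i) = H-other _ _

    -- Unlike `2 * i`, this unfolds to two successors, matching the two-step recursion of `s`.
    double : ℕ → ℕ
    double zero    = zero
    double (suc i) = suc (suc (double i))

    double-+ : ∀ i d → double (i + d) ≡ double i + double d
    double-+ zero    d = refl
    double-+ (suc i) d = cong (2 +_) (double-+ i d)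

    -- The walk is reversible: `s i` is the neighbour of the next vertex that differs from the one
    -- after it.
    s-back : ∀ i → s i ≡ other (s (suc i)) (s (suc (suc i)))
    s-back i = other-unique (s-H (suc i)) (H-sym (s-H i)) (other≢ _ _ ∘ sym)

    s-colour₂ : ∀ i → colour (s (suc (suc i))) ≡ colour (s i)
    s-colour₂ i = trans (switch (s-H (suc i)))
      (trans (cong not (switch (s-H i))) (not-involutive _))

    s-false : ∀ i → colour (s (suc (double i))) ≡ false
    s-true  : ∀ i → colour (s (double i)) ≡ true
    s-true zero    = trans (switch (N.P-fst w₀)) (cong not w₀-false)
    s-true (suc i) = trans (s-colour₂ (double i)) (s-true i)
    s-false i = trans (switch (s-H (double i))) (cong not (s-true i))

    -- Colours alternate along the walk, so an odd distance would change the colour.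
    even : ∀ d {i} → colour (s (d + i)) ≡ colour (s i) → ∃ λ m → d ≡ double m
    even zero          _ = zero , refl
    even (suc zero) {i} p = contradiction (trans (sym p) (switch (s-H i))) (not-¬ refl)
    even (suc (suc d)) {i} p with even d (trans (sym (s-colour₂ (d + i))) p)
    ... | m , refl = suc m , refl

    -- A walk that met an earlier dart reversed would fold onto itself and
    -- turn back at the midpoint.
    no-reversal : ∀ m i → s i ≡ s (suc (suc (double m)) + i) →
                  s (suc i) ≡ s (suc (double m) + i) → ⊥
    no-reversal zero    i p _ = other≢ _ _ (sym p)
    no-reversal (suc m) i p q = no-reversal m (suc i)
      (trans q (cong (λ j → s (2 + j)) (sym (+-suc (double m) i))))
      (begin
        other (s (suc i)) (s i)  ≡⟨ cong₂ other q p ⟩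
        other (s (suc (suc (suc D)))) (s (suc (suc (suc (suc D)))))  ≡⟨ s-back (2 + D) ⟨
        s (suc (suc D))          ≡⟨ cong (λ j → s (suc j)) (+-suc (double m) i) ⟨
        s (suc (double m) + suc i) ∎)
      where
      open ≡-Reasoning
      D = double m + i

    -- The next vertex after the first visit is either the predecessor or the successor of the
    -- second visit; the former is a reversal, which `no-reversal` excludes.
    forward : ∀ d i → s i ≡ s (suc d + i) → s (suc i) ≡ s (suc (suc d + i))
    forward d i p with even (suc d) (sym (cong colour p))
    ... | suc m , refl with nbr-cases {x = s i}
            (subst (λ x → H x (s (suc (double m) + i))) (sym p) (H-sym (s-H (suc (double m) + i)))) (s-H i)
    ...   | inj₁ q = ⊥-elim (no-reversal m i p q)
    ...   | inj₂ q = trans q (cong (λ x → other x (s (suc (double m) + i))) p)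

    -- By reversibility a repetition can be pulled back step by step, so the walk is periodic from
    -- its very start.
    backward : ∀ d i → s i ≡ s (suc d + i) → s 0 ≡ s (suc d)
    backward d zero    p = trans p (cong s (+-identityʳ (suc d)))
    backward d (suc i) p = backward d i (begin
      s i                                 ≡⟨ s-back i ⟩
      other (s (suc i)) (s (suc (suc i))) ≡⟨ cong₂ other p (forward d (suc i) p) ⟩
      other (s (suc d + suc i)) (s (suc (suc d + suc i))) ≡⟨ cong (λ j → other (s (suc j)) (s (suc (suc j)))) (+-suc d i) ⟩
      other (s (suc (suc d + i))) (s (suc (suc (suc d + i)))) ≡⟨ s-back (suc d + i) ⟨
      s (suc d + i)                       ∎)
      where open ≡-Reasoning

    -- Two of the first `n + 1` vertices coincide by the pigeonhole principle, `backward` moves the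
    -- coincidence to index 0, and `even` gives the parity of the period.
    returns : ∃ λ k → s 0 ≡ s (double (suc k))
    returns with pigeonhole (n<1+n n) (s ∘ toℕ)
    ... | i , j , i<j , si≡sj with m≤n⇒∃[o]m+o≡n i<j
    ...   | d , 1+i+d≡j = go (even (suc d) {0} (trans (cong (colour ∘ s) (+-identityʳ (suc d))) (cong colour (sym s0≡)))) s0≡
      where
      s0≡ : s 0 ≡ s (suc d)
      s0≡ = backward d (toℕ i)
        (trans si≡sj (cong s (trans (sym 1+i+d≡j) (cong suc (+-comm (toℕ i) d)))))
      go : ∀ {d} → (∃ λ m → suc d ≡ double m) → s 0 ≡ s (suc d) → ∃ λ k → s 0 ≡ s (double (suc k))
      go (suc m , refl) p = m , p

    period : ∃ λ k → s 0 ≡ s (double (suc k)) × (∀ {c} → c < k → s 0 ≢ s (double (suc c)))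
    period = least (λ k → s 0 ≟ s (double (suc k))) (proj₁ returns) (proj₂ returns)

    module Closed (k′ : ℕ) (s-closed : s 0 ≡ s (double (suc k′)))
                  (k-least : ∀ {c} → c < k′ → s 0 ≢ s (double (suc c))) where

      k : ℕ
      k = suc k′

      -- A repetition at a shorter distance would pull back to an earlier return, against the
      -- minimality of the period.
      s-separated : ∀ d i → suc d < k → s i ≢ s (double (suc d) + i)
      s-separated d i (s≤s d<k′) p =
        k-least d<k′ (backward (suc (double d)) i p)

      -- The offset `b` is 0 for the vertices `v` and 1 for the vertices `u`.
      s-inj : ∀ b → (∀ {i j} → i < j → j < k → s (b + double i) ≢ s (b + double j))
      s-inj b {i} {j} i<j j<k p with m≤n⇒∃[o]m+o≡n i<j
      ... | d , refl = s-separated d (b + double i) (≤-trans (s≤s (s≤s (m≤n+m d i))) j<k)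
        (trans p (cong s (begin
          b + double (suc i + d)                ≡⟨ cong (λ x → b + suc (suc x)) (trans (cong double (+-comm i d)) (double-+ d i)) ⟩
          b + (double (suc d) + double i)       ≡⟨ +-assoc b (double (suc d)) (double i) ⟨
          b + double (suc d) + double i         ≡⟨ cong (_+ double i) (+-comm b (double (suc d))) ⟩
          double (suc d) + b + double i         ≡⟨ +-assoc (double (suc d)) b (double i) ⟩
          double (suc d) + (b + double i)       ∎)))
        where open ≡-Reasoning

      s-inj-Fin : ∀ b {i j : Fin k} → s (b + double (toℕ i)) ≡ s (b + double (toℕ j)) → i ≡ j
      s-inj-Fin b {i} {j} p with <-cmp (toℕ i) (toℕ j)
      ... | tri< i<j _ _ = contradiction p (s-inj b i<j (toℕ<n j))
      ... | tri≈ _ i≡j _ = toℕ-injective i≡j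
      ... | tri> _ _ j<i = contradiction (sym p) (s-inj b j<i (toℕ<n i))

      v u : Fin k → Fin n
      v i = s (double (toℕ i))
      u i = s (suc (double (toℕ i)))

      v-inj : ∀ {i j} → v i ≡ v j → i ≡ j
      v-inj = s-inj-Fin 0

      u-inj : ∀ {i j} → u i ≡ u j → i ≡ j
      u-inj = s-inj-Fin 1

      v-true : ∀ i → colour (v i) ≡ true
      v-true i = s-true (toℕ i)

      u-false : ∀ i → colour (u i) ≡ false
      u-false i = s-false (toℕ i)

      v≢u : ∀ {i j} → v i ≢ u j
      v≢u {i} {j} p with trans (sym (v-true i)) (trans (cong colour p) (u-false j))
      ... | ()

      H-vu : ∀ i → H (v i) (u i)
      H-vu i = s-H (double (toℕ i))

      next-v : ∀ {i j} → CycSucc k i j → v j ≡ other (u i) (v i)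
      next-v (inj₁ j≡1+i) = cong (s ∘ double) j≡1+i
      next-v {i} (inj₂ (1+i≡k , j≡0)) =
        trans (cong (s ∘ double) j≡0) (trans s-closed (cong (s ∘ double) (sym 1+i≡k)))

      next-u : ∀ {i j} → CycSucc k i j → u j ≡ other (v j) (u i)
      next-u {i} {j} (inj₁ j≡1+i) = trans (cong (λ j → s (suc (double j))) j≡1+i)
        (cong (λ x → other (s (double x)) (u i)) (sym j≡1+i))
      next-u {i} {j} (inj₂ (1+i≡k , j≡0)) = begin
        u j                           ≡⟨ cong (λ j → s (suc (double j))) j≡0 ⟩
        -- The walk closes with its direction as well: `forward` carries the return at `s 0` on to
        -- `s 1`.
        s 1                           ≡⟨ forward (suc (double k′)) 0 (trans s-closed (cong s (sym (+-identityʳ (double k))))) ⟩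
        s (suc (double k + 0))        ≡⟨ cong (λ j → s (suc j)) (+-identityʳ (double k)) ⟩
        s (suc (double k))            ≡⟨ cong (λ j → s (suc (double j))) 1+i≡k ⟨
        other (s (double (suc (toℕ i)))) (u i)  ≡⟨ cong (λ x → other x (u i)) (sym (next-v {i} {j} (inj₂ (1+i≡k , j≡0)))) ⟩
        other (v j) (u i)             ∎
        where open ≡-Reasoning

      H-uv′ : ∀ {i j} → CycSucc k i j → H (u i) (v j)
      H-uv′ {i} c = subst (H (u i)) (sym (next-v c)) (H-other _ _)

      u-nbr : ∀ {i x} → H (u i) x → x ≡ v i ⊎ ∃ λ j → CycSucc k i j × x ≡ v j
      u-nbr {i} h with nbr-cases (H-sym (H-vu i)) h
      ... | inj₁ p = inj₁ p
      ... | inj₂ p = let j , c = cycSucc-exists i in inj₂ (j , c , trans p (sym (next-v c)))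

      v-nbr : ∀ {j x} → H (v j) x → ∃ λ i → x ≡ u i
      v-nbr {j} h with cycPred-exists j
      ... | i , c with nbr-cases (H-sym (H-uv′ c)) h
      ...   | inj₁ p = i , p
      ...   | inj₂ p = j , trans p (sym (next-u c))

      g : SunV k → Fin n
      g (inj₁ i) = v i
      g (inj₂ i) = u i

      Image : Fin n → Set
      Image x = ∃ λ y → g y ≡ x

      u-adj : ∀ {i x} → Adj G (u i) x → H (u i) x
      u-adj {i} a = cross a (trans (indep a (u-false i)) (cong not (sym (u-false i))))

      v-cross : ∀ i {x} → Adj G (v i) x → colour x ≡ false → H (v i) x
      v-cross i a cx = cross a (trans cx (cong not (sym (v-true i))))

      -- Crossing edges run along the cycle. An edge inside the class `true` has, by `linked`, a
      -- detour of two crossing edges, so it does not leave the cycle either.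
      image-step : ∀ {x y} → Image x → Adj G x y → Image y
      image-step (inj₂ i , refl) a with u-nbr {i} (u-adj {i} a)
      ... | inj₁ p           = inj₁ i , sym p
      ... | inj₂ (j , _ , p) = inj₁ j , sym p
      image-step {y = y} (inj₁ i , refl) a with colour y in cy
      ... | false = let j , p = v-nbr {i} (v-cross i a cy) in inj₂ j , sym p
      ... | true with linked a (v-true i) cy
      ...   | w , cw , aw , wa with v-nbr {i} (v-cross i aw cw)
      ...     | j , refl with u-nbr {j} (u-adj {j} wa)
      ...       | inj₁ p           = inj₁ j , sym p
      ...       | inj₂ (l , _ , p) = inj₁ l , sym p

      image-reach : ∀ {x y} → Image x → Reach G x y → Image y
      image-reach im here       = im
      image-reach im (step a r) = image-reach (image-step im a) r

      g-surj : ∀ x → Image x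
      g-surj x = image-reach (inj₁ zero , refl) (conn (v zero) x)

      g-inj : ∀ {x y} → g x ≡ g y → x ≡ y
      g-inj {inj₁ i} {inj₁ j} p = cong inj₁ (v-inj p)
      g-inj {inj₁ i} {inj₂ j} p = contradiction p (v≢u {i} {j})
      g-inj {inj₂ i} {inj₁ j} p = contradiction (sym p) (v≢u {j} {i})
      g-inj {inj₂ i} {inj₂ j} p = cong inj₂ (u-inj p)

      e : Fin k → Bool
      e = link ∘ u

      adj-vv′ : ∀ {i j} → CycSucc k i j → adj G (v i) (v j) ≡ e i
      adj-vv′ {i} c = trans (cong (adj G (v i)) (next-v c)) (adj-other (H-sym (H-vu i)))

      uv⇒ : ∀ {i j} → Adj G (u i) (v j) → i ≡ j ⊎ CycSucc k i j
      uv⇒ {i} {j} a with u-nbr {i} (u-adj {i} a)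
      ... | inj₁ p = inj₁ (sym (v-inj p))
      ... | inj₂ (l , c , p) = inj₂ (subst (CycSucc k i) (sym (v-inj p)) c)

      -- The common neighbour given by `linked` is some `u l`, and both ends must be among its two
      -- cycle neighbours; coinciding ends would make a loop.
      vv⇒ : ∀ {i j} → Adj G (v i) (v j) → Sym (OptEdge k e) (inj₁ i) (inj₁ j)
      vv⇒ {i} {j} a with linked a (v-true i) (v-true j)
      ... | w , cw , aw , wa with v-nbr {i} (v-cross i aw cw)
      ...   | l , refl with uv⇒ {l} {i} (adj-sym aw) | uv⇒ {l} {j} wa
      ...     | inj₁ refl | inj₁ refl = contradiction (trans (sym a) (irrefl G (v i))) λ ()
      ...     | inj₁ refl | inj₂ c    = inj₁ (c , trans (sym (adj-vv′ c)) a)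
      ...     | inj₂ c    | inj₁ refl = inj₂ (c , trans (sym (adj-vv′ c)) (adj-sym a))
      ...     | inj₂ c    | inj₂ c′ with cycSucc-functional c c′
      ...       | refl = contradiction (trans (sym a) (irrefl G (v i))) λ ()

      walk-iso : IsoTo G (SunV k) (OptEdge k e)
      walk-iso = bijective⇒iso G g g-inj g-surj adj⇔
        where
        adj⇔ : ∀ x y → (Adj G (g x) (g y) → Sym (OptEdge k e) x y) × (OptEdge k e x y → Adj G (g x) (g y))
        adj⇔ (inj₁ i) (inj₁ j) = vv⇒ , λ (c , t) → trans (adj-vv′ c) t
        adj⇔ (inj₁ i) (inj₂ j) = inj₂ ∘ uv⇒ ∘ adj-sym , λ ()
        adj⇔ (inj₂ i) (inj₁ j) = inj₁ ∘ uv⇒ , λ { (inj₁ refl) → adj-sym (edge (H-vu i)) ; (inj₂ c) → edge (H-uv′ c) }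
        adj⇔ (inj₂ i) (inj₂ j) = (λ a → contradiction (trans (sym (indep a (u-false i))) (u-false j)) λ ()) , λ ()

      -- For length 1 the two neighbours of `u zero` would coincide.
      2≤k : 2 ≤ k
      2≤k = ≤∧≢⇒< (s≤s z≤n) λ 1≡k →
        other≢ (u zero) (v zero) (sym (next-v {zero} {zero} (inj₂ (1≡k , refl))))

      -- Both `w₀` and the last `u` are the neighbour of `v zero` other than `u zero`. Hence a
      -- missing chord over `w₀` lands at the last index.
      e-last : e (fromℕ k′) ≡ link w₀
      e-last = cong link (trans (other-unique (H-vu zero) (H-sym (H-uv′ c)) (λ p → other≢ _ _ (trans (sym (next-u c)) (sym p))))
          (sym (other-unique (H-other _ _) (H-sym (N.P-fst w₀)) (λ p → other≢ _ _ (sym p)))))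
        where
        c : CycSucc k (fromℕ k′) zero
        c = inj₂ (cong suc (toℕ-fromℕ k′) , refl)

open AlternatingCycles using (colour)

-- Transporting edge relations along bijections.

-- Only symmetric closures are compared, because the same undirected edge may be oriented
-- differently on the two sides.
SameEdges : ∀ {V W : Set} → V ↔ W → (V → V → Set) → (W → W → Set) → Set
SameEdges τ E F = ∀ x y → Sym E x y ⇔ Sym F (to τ x) (to τ y)

relabel : ∀ {n} (G : Graph n) {V W : Set} (E : V → V → Set) (F : W → W → Set) (τ : V ↔ W) →
          SameEdges τ E F → IsoTo G V E → IsoTo G W F
relabel G E F τ same (σ , adj⇔) = ↔-trans σ τ , λ x y →
  Equivalence.to (same _ _) ∘ proj₁ (adj⇔ x y) , proj₂ (adj⇔ x y) ∘ Equivalence.from (same _ _)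

sameEdges-sym : ∀ {V W : Set} (E : V → V → Set) (F : W → W → Set) (τ : V ↔ W) →
                SameEdges τ E F → SameEdges (↔-sym τ) F E
sameEdges-sym E F τ same x y = mk⇔
  (Equivalence.from (same _ _) ∘ subst₂ (Sym F) (sym (strictlyInverseˡ τ x)) (sym (strictlyInverseˡ τ y)))
  (subst₂ (Sym F) (strictlyInverseˡ τ x) (strictlyInverseˡ τ y) ∘ Equivalence.to (same _ _))

sameEdges-directed : ∀ {V W : Set} (E : V → V → Set) (F : W → W → Set) (τ : V ↔ W) →
  (∀ x y → E x y → F (to τ x) (to τ y)) → (∀ x y → F (to τ x) (to τ y) → E x y) → SameEdges τ E F
sameEdges-directed E F τ E⇒F F⇒E x y =
  mk⇔ (Sum.map (E⇒F x y) (E⇒F y x)) (Sum.map (F⇒E x y) (F⇒E y x))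

sun≅opt : ∀ k (e : Fin k → Bool) → (∀ i → e i ≡ true) →
          SameEdges (↔-id (SunV k)) (SunEdge k) (OptEdge k e)
sun≅opt k e all-true = sameEdges-directed (SunEdge k) (OptEdge k e) (↔-id _) ⇒ ⇐
  where
  ⇒ : ∀ x y → SunEdge k x y → OptEdge k e x y
  ⇒ (inj₁ i) (inj₁ j) c = c , all-true i
  ⇒ (inj₂ i) (inj₁ j) c = c
  ⇐ : ∀ x y → OptEdge k e x y → SunEdge k x y
  ⇐ (inj₁ i) (inj₁ j) = proj₁
  ⇐ (inj₂ i) (inj₁ j) = id

-- On two cycle vertices v₀v₁ and v₁v₀ are the same edge, so one of the two
-- marks is redundant.
opt₂ : ∀ (e : Fin 2 → Bool) → (∀ i → e i ≡ true) →
       SameEdges (↔-id (SunV 2)) (OptEdge 2 e) (OptEdge 2 (true ∷ false ∷ λ ()))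
opt₂ e all-true x y = mk⇔ (⇒ x y) (⇐ x y)
  where
  e′ = true ∷ false ∷ λ ()
  ⇒₁ : ∀ x y → OptEdge 2 e x y → Sym (OptEdge 2 e′) x y
  ⇒₁ (inj₁ zero) (inj₁ zero) (inj₁ () , _)
  ⇒₁ (inj₁ zero) (inj₁ zero) (inj₂ (() , _) , _)
  ⇒₁ (inj₁ zero) (inj₁ (suc zero)) _ = inj₁ (inj₁ refl , refl)
  ⇒₁ (inj₁ (suc zero)) (inj₁ zero) _ = inj₂ (inj₁ refl , refl)
  ⇒₁ (inj₁ (suc zero)) (inj₁ (suc zero)) (inj₁ () , _)
  ⇒₁ (inj₁ (suc zero)) (inj₁ (suc zero)) (inj₂ (_ , ()) , _)
  ⇒₁ (inj₂ i) (inj₁ j) c = inj₁ c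
  ⇒ : ∀ x y → Sym (OptEdge 2 e) x y → Sym (OptEdge 2 e′) x y
  ⇒ x y (inj₁ c) = ⇒₁ x y c
  ⇒ x y (inj₂ c) = Sum.swap (⇒₁ y x c)
  ⇐₁ : ∀ x y → OptEdge 2 e′ x y → OptEdge 2 e x y
  ⇐₁ (inj₁ i) (inj₁ j) (c , _) = c , all-true i
  ⇐₁ (inj₂ i) (inj₁ j) c = c
  ⇐ : ∀ x y → Sym (OptEdge 2 e′) x y → Sym (OptEdge 2 e) x y
  ⇐ x y = Sum.map (⇐₁ x y) (⇐₁ y x)

-- Blocks laid end to end around the cycle.

total : ∀ r → (Fin r → ℕ) → ℕ
total zero    ks = 0
total (suc r) ks = ks zero + total r (ks ∘ suc)

start : ∀ {r} → (Fin r → ℕ) → Fin r → ℕ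
start ks zero    = 0
start ks (suc i) = ks zero + start (ks ∘ suc) i

pos : ∀ {r} (ks : Fin r → ℕ) i → Fin (ks i) → Fin (total r ks)
pos ks zero    a = a ↑ˡ _
pos ks (suc i) a = ks zero ↑ʳ pos (ks ∘ suc) i a

toℕ-pos : ∀ {r} (ks : Fin r → ℕ) i a → toℕ (pos ks i a) ≡ start ks i + toℕ a
toℕ-pos ks zero    a = toℕ-↑ˡ a _
toℕ-pos ks (suc i) a = trans (toℕ-↑ʳ (ks zero) _)
  (trans (cong (ks zero +_) (toℕ-pos (ks ∘ suc) i a)) (sym (+-assoc (ks zero) _ _)))

Slot : ∀ {r} → (Fin r → ℕ) → Set
Slot {r} ks = Σ (Fin r) (Fin ∘ ks)

unpos : ∀ {r} (ks : Fin r → ℕ) → Fin (total r ks) → Slot ks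
unpos {suc r} ks x with splitAt (ks zero) x
... | inj₁ a = zero , a
... | inj₂ y = let i , a = unpos (ks ∘ suc) y in suc i , a

unpos-pos : ∀ {r} (ks : Fin r → ℕ) i a → unpos ks (pos ks i a) ≡ (i , a)
unpos-pos {suc r} ks zero    a rewrite splitAt-↑ˡ (ks zero) a (total r (ks ∘ suc)) = refl
unpos-pos {suc r} ks (suc i) a
  rewrite splitAt-↑ʳ (ks zero) (total r (ks ∘ suc)) (pos (ks ∘ suc) i a)
        | unpos-pos (ks ∘ suc) i a = refl

pos-unpos : ∀ {r} (ks : Fin r → ℕ) x → pos ks (proj₁ (unpos ks x)) (proj₂ (unpos ks x)) ≡ x
pos-unpos {suc r} ks x with splitAt (ks zero) x | join-splitAt (ks zero) (total r (ks ∘ suc)) x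
... | inj₁ a | p = p
... | inj₂ y | p = trans (cong (ks zero ↑ʳ_) (pos-unpos (ks ∘ suc) y)) p

pos-injective : ∀ {r} (ks : Fin r → ℕ) i a j b → pos ks i a ≡ pos ks j b → (i , a) ≡ (j , b)
pos-injective ks i a j b p = trans (sym (unpos-pos ks i a)) (trans (cong (unpos ks) p) (unpos-pos ks j b))

start-suc : ∀ {r} (ks : Fin r → ℕ) {i j} → toℕ j ≡ suc (toℕ i) → start ks j ≡ start ks i + ks i
start-suc ks {zero}  {suc zero} _ = +-identityʳ (ks zero)
start-suc {suc r} ks {suc i} {suc j} p = trans
  (cong (ks zero +_) (start-suc (ks ∘ suc) (ℕ.suc-injective p))) (sym (+-assoc (ks zero) _ _))

start-last : ∀ {r} (ks : Fin r → ℕ) {i} → suc (toℕ i) ≡ r → start ks i + ks i ≡ total r ks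
start-last {suc zero}    ks {zero}  _ = sym (+-identityʳ (ks zero))
start-last {suc r} ks {suc i} p = trans (+-assoc (ks zero) _ _)
  (cong (ks zero +_) (start-last (ks ∘ suc) (ℕ.suc-injective p)))

start-first : ∀ {r} (ks : Fin r → ℕ) {i} → toℕ i ≡ 0 → start ks i ≡ 0
start-first ks {zero} _ = refl

-- In a block of `k` slots, the `u`-vertex after each slot but the last is the tip of a triangle;
-- the one after the last slot, `slotW`, is the connecting vertex.
slotU : ∀ k → Fin (k ∸ 1) → Fin k
slotU (suc k) a = inject₁ a

toℕ-slotU : ∀ k a → toℕ (slotU k a) ≡ toℕ a
toℕ-slotU (suc k) a = toℕ-inject₁ a

slotU< : ∀ k a → suc (toℕ (slotU k a)) < k
slotU< (suc k) a rewrite toℕ-inject₁ a = s≤s (toℕ<n a)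

slotW : ∀ k → 1 ≤ k → Fin k
slotW (suc k) _ = fromℕ k

toℕ-slotW : ∀ k (1≤k : 1 ≤ k) → suc (toℕ (slotW k 1≤k)) ≡ k
toℕ-slotW (suc k) _ = cong suc (toℕ-fromℕ k)

unslot : ∀ {k} → Fin k → BlockV k
unslot {suc k} a with view a
... | ‵fromℕ     = con
... | ‵inject₁ b = tri-u b

unslot-slotU : ∀ k a → unslot (slotU k a) ≡ tri-u a
unslot-slotU (suc k) a rewrite view-inject₁ a = refl

unslot-slotW : ∀ k 1≤k → unslot (slotW k 1≤k) ≡ con
unslot-slotW (suc k) _ rewrite view-fromℕ k = refl

unslot-view : ∀ {k} (a : Fin k) →
  (∃ λ b → a ≡ slotU k b × unslot a ≡ tri-u b) ⊎
  ((∀ 1≤k → a ≡ slotW k 1≤k) × unslot a ≡ con)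
unslot-view {suc k} a with view a
... | ‵fromℕ     = inj₂ ((λ _ → refl) , refl)
... | ‵inject₁ b = inj₁ (b , refl , refl)

module Blocks {r : ℕ} (ks : Fin r → ℕ) (ks≥1 : ∀ i → 1 ≤ ks i) where

  K : ℕ
  K = total r ks

  -- The cyclic successor in block coordinates: one step inside a block, or from its last slot to
  -- the first slot of the next block.
  SlotSucc : Slot ks → Slot ks → Set
  SlotSucc (i , a) (j , b) =
    (i ≡ j × toℕ b ≡ suc (toℕ a)) ⊎
    (suc (toℕ a) ≡ ks i × CycSucc r i j × toℕ b ≡ 0)

  slotSucc-exists : ∀ p → ∃ (SlotSucc p)
  slotSucc-exists (i , a) with suc (toℕ a) ℕ.≟ ks i
  ... | no 1+a≢ = let 1+a< = ≤∧≢⇒< (toℕ<n a) 1+a≢ in (i , fromℕ< 1+a<) , inj₁ (refl , toℕ-fromℕ< 1+a<)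
  ... | yes 1+a≡ = let j , c = cycSucc-exists i in
    (j , fromℕ< (ks≥1 j)) , inj₂ (1+a≡ , c , toℕ-fromℕ< (ks≥1 j))

  slotSucc⇒cycSucc : ∀ i a j b → SlotSucc (i , a) (j , b) → CycSucc K (pos ks i a) (pos ks j b)
  slotSucc⇒cycSucc i a .i b (inj₁ (refl , b≡)) = inj₁ (begin
    toℕ (pos ks i b)            ≡⟨ toℕ-pos ks i b ⟩
    start ks i + toℕ b          ≡⟨ cong (start ks i +_) b≡ ⟩
    start ks i + suc (toℕ a)    ≡⟨ +-suc _ _ ⟩
    suc (start ks i + toℕ a)    ≡⟨ cong suc (toℕ-pos ks i a) ⟨
    suc (toℕ (pos ks i a))      ∎)
    where open ≡-Reasoning
  slotSucc⇒cycSucc i a j b (inj₂ (1+a≡ , c , b≡0)) = Sum.map inside wrap c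
    where
    open ≡-Reasoning
    end : suc (toℕ (pos ks i a)) ≡ start ks i + ks i
    end = begin
      suc (toℕ (pos ks i a))    ≡⟨ cong suc (toℕ-pos ks i a) ⟩
      suc (start ks i + toℕ a)  ≡⟨ +-suc _ _ ⟨
      start ks i + suc (toℕ a)  ≡⟨ cong (start ks i +_) 1+a≡ ⟩
      start ks i + ks i         ∎
    begins : toℕ (pos ks j b) ≡ start ks j
    begins = trans (toℕ-pos ks j b) (trans (cong (start ks j +_) b≡0) (+-identityʳ _))
    inside : toℕ j ≡ suc (toℕ i) → toℕ (pos ks j b) ≡ suc (toℕ (pos ks i a))
    inside p = trans begins (trans (start-suc ks p) (sym end))
    wrap : suc (toℕ i) ≡ r × toℕ j ≡ 0 → suc (toℕ (pos ks i a)) ≡ K × toℕ (pos ks j b) ≡ 0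
    wrap (p , q) = trans end (start-last ks p) , trans begins (start-first ks q)

  -- Needs no arithmetic: every slot has a successor in block coordinates, and cyclic successors are
  -- unique.
  cycSucc⇒slotSucc : ∀ i a j b → CycSucc K (pos ks i a) (pos ks j b) → SlotSucc (i , a) (j , b)
  cycSucc⇒slotSucc i a j b c with slotSucc-exists (i , a)
  ... | (j′ , b′) , s
    with pos-injective ks j b j′ b′ (cycSucc-functional c (slotSucc⇒cycSucc i a j′ b′ s))
  ...   | refl = s

  toSun : GV r ks → SunV K
  toSun (i , tri-v a) = inj₁ (pos ks i a)
  toSun (i , tri-u a) = inj₂ (pos ks i (slotU (ks i) a))
  toSun (i , con)     = inj₂ (pos ks i (slotW (ks i) (ks≥1 i)))

  fromSun : SunV K → GV r ks
  fromSun (inj₁ x) = let i , a = unpos ks x in i , tri-v a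
  fromSun (inj₂ x) = let i , a = unpos ks x in i , unslot a

  blocks↔sun : GV r ks ↔ SunV K
  blocks↔sun = mk↔ₛ′ toSun fromSun to-from from-to
    where
    toSun-unslot : ∀ i a → toSun (i , unslot a) ≡ inj₂ (pos ks i a)
    toSun-unslot i a with unslot a | unslot-view a
    ... | _ | inj₁ (b , refl , refl) = refl
    ... | _ | inj₂ (a≡ , refl)       = cong (inj₂ ∘ pos ks i) (sym (a≡ (ks≥1 i)))
    to-from : ∀ y → toSun (fromSun y) ≡ y
    to-from (inj₁ x) = cong inj₁ (pos-unpos ks x)
    to-from (inj₂ x) = trans (toSun-unslot (proj₁ (unpos ks x)) (proj₂ (unpos ks x)))
      (cong inj₂ (pos-unpos ks x))
    from-to : ∀ x → fromSun (toSun x) ≡ x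
    from-to (i , tri-v a) rewrite unpos-pos ks i a = refl
    from-to (i , tri-u a) rewrite unpos-pos ks i (slotU (ks i) a) = cong (i ,_) (unslot-slotU (ks i) a)
    from-to (i , con) rewrite unpos-pos ks i (slotW (ks i) (ks≥1 i)) = cong (i ,_) (unslot-slotW (ks i) (ks≥1 i))

  -- Chords are missing exactly at the last slots of blocks, where a connecting vertex bridges to
  -- the next block.
  Marks : (Fin K → Bool) → Set
  Marks e = ∀ i a → e (pos ks i a) ≡ (suc (toℕ a) <ᵇ ks i)

  blocks≅opt : ∀ e → Marks e → SameEdges blocks↔sun (GEdge r ks) (OptEdge K e)
  blocks≅opt e marks = sameEdges-directed (GEdge r ks) (OptEdge K e) blocks↔sun ⇒ ⇐
    where
    marked : ∀ {i a} → suc (toℕ a) < ks i → e (pos ks i a) ≡ true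
    marked {i} {a} lt = trans (marks i a) (Equivalence.to Bool.T-≡ (<⇒<ᵇ lt))
    marked⁻ : ∀ {i a} → e (pos ks i a) ≡ true → suc (toℕ a) < ks i
    marked⁻ {i} {a} t = <ᵇ⇒< _ _ (Equivalence.from Bool.T-≡ (trans (sym (marks i a)) t))

    same-pos : ∀ i {a b : Fin (ks i)} → toℕ b ≡ toℕ a → pos ks i a ≡ pos ks i b
    same-pos i p = cong (pos ks i) (toℕ-injective (sym p))

    ⇒ : ∀ x y → GEdge r ks x y → OptEdge K e (toSun x) (toSun y)
    ⇒ (i , tri-v a) (.i , tri-v b) (refl , b≡) =
      slotSucc⇒cycSucc i a i b (inj₁ (refl , b≡)) ,
      marked (subst (_< ks i) b≡ (toℕ<n b))
    ⇒ (i , tri-u a) (.i , tri-v b) (refl , inj₁ b≡a) =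
      inj₁ (same-pos i (trans b≡a (sym (toℕ-slotU (ks i) a))))
    ⇒ (i , tri-u a) (.i , tri-v b) (refl , inj₂ b≡) = inj₂ (slotSucc⇒cycSucc i _ i b
      (inj₁ (refl , trans b≡ (cong suc (sym (toℕ-slotU (ks i) a))))))
    ⇒ (i , con) (.i , tri-v b) (inj₁ (refl , 1+b≡)) =
      inj₁ (same-pos i (ℕ.suc-injective (trans 1+b≡ (sym (toℕ-slotW (ks i) (ks≥1 i))))))
    ⇒ (i , con) (j , tri-v b) (inj₂ (c , b≡0)) =
      inj₂ (slotSucc⇒cycSucc i _ j b (inj₂ (toℕ-slotW (ks i) (ks≥1 i) , c , b≡0)))

    ⇐ : ∀ x y → OptEdge K e (toSun x) (toSun y) → GEdge r ks x y
    ⇐ (i , tri-v a) (j , tri-v b) (c , t) with cycSucc⇒slotSucc i a j b c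
    ... | inj₁ s = s
    -- A marked slot is not the last one, so its chord cannot leave the block.
    ... | inj₂ (1+a≡ , _) = contradiction 1+a≡ (<⇒≢ (marked⁻ t))
    ⇐ (i , tri-v a) (j , tri-u b) ()
    ⇐ (i , tri-v a) (j , con) ()
    ⇐ (i , tri-u a) (j , tri-v b) (inj₁ p) with pos-injective ks i _ j b p
    ... | refl = refl , inj₁ (toℕ-slotU (ks i) a)
    ⇐ (i , tri-u a) (j , tri-v b) (inj₂ c) with cycSucc⇒slotSucc i _ j b c
    ... | inj₁ (i≡j , b≡) = i≡j , inj₂ (trans b≡ (cong suc (toℕ-slotU (ks i) a)))
    ... | inj₂ (1+a≡ , _) = contradiction 1+a≡ (<⇒≢ (slotU< (ks i) a))
    ⇐ (i , con) (j , tri-v b) (inj₁ p) with pos-injective ks i _ j b p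
    ... | refl = inj₁ (refl , toℕ-slotW (ks i) (ks≥1 i))
    ⇐ (i , con) (j , tri-v b) (inj₂ c) with cycSucc⇒slotSucc i _ j b c
    ... | inj₁ (refl , b≡) = contradiction (trans b≡ (toℕ-slotW (ks i) (ks≥1 i))) (<⇒≢ (toℕ<n b))
    ... | inj₂ (_ , c′ , b≡0) = inj₂ (c′ , b≡0)

-- Cutting the cycle at the missing chords.

-- The field `marks` identifies an index by its value, since `Fin (total r ks)` and `Fin k` agree
-- only through `total≡k`.
record Decomposition (k : ℕ) (e : Fin k → Bool) : Set where
  field
    r       : ℕ
    ks      : Fin r → ℕ
    ks≥1    : ∀ i → 1 ≤ ks i
    total≡k : total r ks ≡ k
    marks   : ∀ i (a : Fin (ks i)) x → toℕ x ≡ start ks i + toℕ a → e x ≡ (suc (toℕ a) <ᵇ ks i)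

-- Induction from the front: an unmarked index forms a block of its own, a marked one lengthens the
-- first block of the rest. The unmarked last index closes the last block.
decompose : ∀ k (e : Fin (suc k) → Bool) → e (fromℕ k) ≡ false → Decomposition (suc k) e
decompose zero e e-last = record
  { r = 1 ; ks = λ _ → 1 ; ks≥1 = λ _ → s≤s z≤n ; total≡k = refl
  ; marks = λ { zero zero zero _ → e-last } }
decompose (suc k) e e-last with e zero in e0 | decompose k (e ∘ suc) e-last
... | false | D = record
  { r = suc r ; ks = 1 ∷ ks
  ; ks≥1 = λ { zero → s≤s z≤n ; (suc i) → ks≥1 i }
  ; total≡k = cong suc total≡k
  ; marks = λ { zero zero zero _ → e0
              ; (suc i) a (suc x) p → marks i a x (ℕ.suc-injective p) } }
  where open Decomposition D
-- The rest covers a positive number of indices, so it has a first block to lengthen.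
... | true | record { r = suc r ; ks = ks ; ks≥1 = ks≥1 ; total≡k = total≡k ; marks = marks } = record
  { r = suc r ; ks = suc (ks zero) ∷ (ks ∘ suc)
  ; ks≥1 = λ { zero → s≤s z≤n ; (suc i) → ks≥1 (suc i) }
  ; total≡k = cong suc total≡k
  ; marks = λ { zero zero zero _ → trans e0 (sym (Equivalence.to Bool.T-≡ (<⇒<ᵇ (ks≥1 zero))))
              ; zero (suc a) (suc x) p → marks zero a x (ℕ.suc-injective p)
              ; (suc i) a (suc x) p → marks (suc i) a x (ℕ.suc-injective p) } }

-- Passing between Ω and suns with optional chords.

OptSun : ∀ {n} → Graph n → Set
OptSun G = Σ ℕ λ k → 2 ≤ k × Σ (Fin k → Bool) λ e → IsoTo G (SunV k) (OptEdge k e)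

Ω⇒optSun : ∀ {n} (G : Graph n) → InΩ G → OptSun G
Ω⇒optSun G (inj₁ (k , 3≤k , iso)) =
  k , ≤-trans (n≤1+n 2) 3≤k , _ ,
  relabel G (SunEdge k) (OptEdge k _) (↔-id _) (sun≅opt k (λ _ → true) (λ _ → refl)) iso
Ω⇒optSun G (inj₂ (r , ks , 1≤r , ks≥1 , r≡1⇒ , iso)) =
  K , 2≤total 1≤r ks≥1 r≡1⇒ , e ,
  relabel G (GEdge r ks) (OptEdge K e) blocks↔sun (blocks≅opt e marks) iso
  where
  open Blocks ks ks≥1
  e : Fin K → Bool
  e x = let i , a = unpos ks x in suc (toℕ a) <ᵇ ks i
  marks : Marks e
  marks i a rewrite unpos-pos ks i a = refl
  2≤total : ∀ {r} {ks : Fin r → ℕ} → 1 ≤ r → (∀ i → 1 ≤ ks i) → (∀ i → r ≡ 1 → 2 ≤ ks i) → 2 ≤ total r ks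
  -- A single block has length at least 2 by the side condition of Ω; otherwise there are two
  -- nonempty blocks.
  2≤total {suc zero}    _ _    r≡1⇒ = ≤-trans (r≡1⇒ zero refl) (m≤m+n _ _)
  2≤total {suc (suc r)} _ ks≥1 _    = +-mono-≤ (ks≥1 zero) (≤-trans (ks≥1 (suc zero)) (m≤m+n _ _))

unmarked-last⇒Ω : ∀ {n} (G : Graph n) k (e : Fin (suc k) → Bool) → 2 ≤ suc k → e (fromℕ k) ≡ false →
  IsoTo G (SunV (suc k)) (OptEdge (suc k) e) → InΩ G
-- The length becomes a variable in `go`, which allows matching `total≡k` with `refl`.
unmarked-last⇒Ω G k e 2≤k e-last iso = go (decompose k e e-last) 2≤k iso
  where
  go : ∀ {k} {e : Fin k → Bool} → Decomposition k e → 2 ≤ k → IsoTo G (SunV k) (OptEdge k e) → InΩ G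
  go {e = e} record { r = r ; ks = ks ; ks≥1 = ks≥1 ; total≡k = refl ; marks = marks } 2≤k iso =
    inj₂ (r , ks , 1≤r ks 2≤k , ks≥1 , single ks 2≤k ,
      relabel G (OptEdge K e) (GEdge r ks) (↔-sym blocks↔sun)
        (sameEdges-sym (GEdge r ks) (OptEdge K e) blocks↔sun (blocks≅opt e (λ i a → marks i a _ (toℕ-pos ks i a)))) iso)
    where
    open Blocks ks ks≥1
    1≤r : ∀ {r} (ks : Fin r → ℕ) → 2 ≤ total r ks → 1 ≤ r
    1≤r {suc r} _ _ = s≤s z≤n
    single : ∀ {r} (ks : Fin r → ℕ) → 2 ≤ total r ks → ∀ i → r ≡ 1 → 2 ≤ ks i
    single ks 2≤ zero refl = ≤-trans 2≤ (≤-reflexive (+-identityʳ (ks zero)))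

-- For length at least 3 this is a sun. For length 2 it is the diamond G(2), reached by dropping the
-- redundant second mark.
all-marked⇒Ω : ∀ {n} (G : Graph n) k (e : Fin k → Bool) → 2 ≤ k → (∀ i → e i ≡ true) →
  IsoTo G (SunV k) (OptEdge k e) → InΩ G
all-marked⇒Ω G (suc zero) _ (s≤s ())
all-marked⇒Ω G (suc (suc zero)) e 2≤k all-true iso =
  unmarked-last⇒Ω G 1 (true ∷ false ∷ λ ()) 2≤k refl
    (relabel G (OptEdge 2 e) (OptEdge 2 (true ∷ false ∷ λ ())) (↔-id _) (opt₂ e all-true) iso)
all-marked⇒Ω G k@(suc (suc (suc _))) e _ all-true iso =
  inj₁ (k , s≤s (s≤s (s≤s z≤n)) ,
    relabel G (OptEdge k e) (SunEdge k) (↔-sym (↔-id _))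
      (sameEdges-sym (SunEdge k) (OptEdge k e) (↔-id _) (sun≅opt k e all-true)) iso)

-- If some chord is missing, the walk is started at the vertex under it, so that the cut falls at
-- the last index; otherwise any start will do.
alternating⇒Ω : ∀ {n} (G : Graph n) → 1 ≤ n → Connected G → AlternatingCycles G → InΩ G
alternating⇒Ω {suc n} G _ conn A with all? (λ w → (colour A w Bool.≟ false) →-dec (link w Bool.≟ true))
  where open Walk G conn A
... | yes linked-all = from-any (colour A zero) refl
  where
  open Walk G conn A
  from-false : ∀ w → colour A w ≡ false → InΩ G
  from-false w cw = all-marked⇒Ω G k e 2≤k (λ i → linked-all (u i) (u-false i)) walk-iso
    where
    open From w cw
    open Closed (proj₁ period) (proj₁ (proj₂ period)) (proj₂ (proj₂ period))
  from-any : ∀ b → colour A zero ≡ b → InΩ G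
  from-any false c = from-false zero c
  from-any true  c = from-false (N.fst zero) (trans (switch (N.P-fst zero)) (cong not c))
... | no ¬all with ¬∀⟶∃¬ (suc n) _ (λ w → (colour A w Bool.≟ false) →-dec (link w Bool.≟ true)) ¬all
  where open Walk G conn A
...   | w , ¬linked = from-false (colour A w) refl
  where
  open Walk G conn A
  from-false : ∀ b → colour A w ≡ b → InΩ G
  -- For `w` of colour `true` the refuted implication would hold vacuously.
  from-false true  c = contradiction (λ c′ → contradiction (trans (sym c) c′) λ ()) ¬linked
  from-false false c = unmarked-last⇒Ω G k′ e 2≤k
    (trans e-last (Bool.¬-not (λ l → ¬linked (λ _ → l)))) walk-iso
    where
    open From w c
    k′ = proj₁ period
    open Closed k′ (proj₁ (proj₂ period)) (proj₂ (proj₂ period))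

-- From a tight CID function to alternating cycles.

nonzero : ℕ → Bool
nonzero zero    = false
nonzero (suc _) = true

pair-map : ∀ {n} {P Q : Fin n → Set} → (∀ x → P x → Q x) → (∀ x → Q x → P x) → Pair P → Pair Q
pair-map P⇒Q Q⇒P p = record
  { fst = fst ; snd = snd ; fst≢snd = fst≢snd ; P-fst = P⇒Q fst P-fst ; P-snd = P⇒Q snd P-snd
  ; only = λ x Qx → only x (Q⇒P x Qx) }
  where open Pair p

tight⇒alternating : ∀ {n} (G : Graph n) → ClawFree G → (f : Fin n → ℕ) → IsCID G f →
  2 * weight f ≡ n → AlternatingCycles G
tight⇒alternating {n} G claw f cid 2w≡n = record
  { colour = c ; nbrs = nbrs′ ; indep = indep′ ; linked = linked′ }
  where
  open Counting G claw f cid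
  open Tight 2w≡n
  c : Fin n → Bool
  c = nonzero ∘ f

  c-false : ∀ {x} → c x ≡ false → f x ≡ 0
  c-false {x} p with f x
  ... | zero = refl

  c-true : ∀ {x} → c x ≡ true → f x ≡ 1
  c-true {x} p with f x | f≤1 x
  ... | suc zero | _ = refl
  ... | suc (suc _) | s≤s ()

  nbrs′ : ∀ x → Pair (Cross G c x)
  nbrs′ x with c x in cx
  ... | false = pair-map
    (λ y m → let a , fy = mask≡1 (adj G x y) m in
      cross a (trans (cong nonzero fy) (cong not (sym cx))))
    (λ { y (cross a cy) → trans (mask-true (f y) a) (c-true (trans cy (cong not cx))) })
    (two-ones _ (λ y → mask≤1 (adj G x y) (f≤1 y))
      (trans (sym (nbrSum≡sum G f x)) (zero-nbrSum x (c-false cx))))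
  ... | true = pair-map
    (λ y m → let a , zy = mask≡1 (adj G x y) m in
      cross a (trans (cong nonzero (isZero≡1 zy)) (cong not (sym cx))))
    (λ { y (cross a cy) → trans (mask-true (z y) a)
           (cong isZero (c-false (trans cy (cong not cx)))) })
    (two-ones _ (zero-nbr≤1 x)
      (trans (sym (nbrSum≡sum G z x)) (one-nbrSum x (c-true cx))))

  indep′ : ∀ {x y} → Adj G x y → c x ≡ false → c y ≡ true
  indep′ {x} {y} a cx with c y in cy
  ... | true  = refl
  ... | false = contradiction (trans (sym a) (indep x y (c-false cx) (c-false cy))) λ ()

  linked′ : ∀ {x y} → Adj G x y → c x ≡ true → c y ≡ true → ∃ λ w → c w ≡ false × Adj G x w × Adj G w y
  linked′ {x} {y} a cx cy with adj G p y in py | adj G q y in qy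
    where open Pair (nbrs′ x) renaming (fst to p; snd to q)
  ... | true | _ = fst , trans (switch P-fst) (cong not cx) , edge P-fst , py
    where open Pair (nbrs′ x)
  ... | false | true = snd , trans (switch P-snd) (cong not cx) , edge P-snd , qy
    where open Pair (nbrs′ x)
  -- Otherwise the two zero neighbours of `x` and the vertex `y` are the leaves of a claw at `x`.
  ... | false | false = ⊥-elim (claw x fst snd y (edge P-fst) (edge P-snd) a
          fst≢snd (≢y cp) (≢y cq)
          (indep fst snd (c-false cp) (c-false cq) , py , qy))
    where
    open Pair (nbrs′ x)
    cp : c fst ≡ false
    cp = trans (switch P-fst) (cong not cx)
    cq : c snd ≡ false
    cq = trans (switch P-snd) (cong not cx)
    ≢y : ∀ {w} → c w ≡ false → w ≢ y
    ≢y cw refl = contradiction (trans (sym cw) cy) λ ()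

-- A CID function of half the order.

optSun⇒light-CID : ∀ {n} (G : Graph n) → OptSun G → Σ (Fin n → ℕ) λ f → IsCID G f × 2 * weight f ≡ n
optSun⇒light-CID {n} G (k , 2≤k , e , σ , adj⇔) = f , (f≤2 , dominating , independent) , 2w≡n
  where
  onCycle : SunV k → ℕ
  onCycle (inj₁ _) = 1
  onCycle (inj₂ _) = 0

  f : Fin n → ℕ
  f = onCycle ∘ to σ

  f-from : ∀ y → f (from σ y) ≡ onCycle y
  f-from y = cong onCycle (strictlyInverseˡ σ y)

  f≤2 : ∀ x → f x ≤ 2
  f≤2 x with to σ x
  ... | inj₁ _ = s≤s z≤n
  ... | inj₂ _ = z≤n

  off : ∀ {y} → onCycle y ≡ 0 → ∃ λ i → y ≡ inj₂ i
  off {inj₂ i} _ = i , refl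

  nbr : ∀ {x i j} → to σ x ≡ inj₂ i → i ≡ j ⊎ CycSucc k i j → Adj G x (from σ (inj₁ j))
  nbr {x} {i} {j} x≡ c = proj₂ (adj⇔ x (from σ (inj₁ j)))
    (subst₂ (Sym (OptEdge k e)) (sym x≡) (sym (strictlyInverseˡ σ (inj₁ j))) (inj₁ c))

  succ≢ : ∀ {i j} → CycSucc k i j → i ≢ j
  succ≢ {i} (inj₁ p) refl = 1+n≢n (sym p)
  -- An index that wraps around to itself would force length 1; so each `u`-vertex sees two
  -- different cycle vertices.
  succ≢ {i} (inj₂ (p , q)) refl = contradiction (trans (sym (cong suc q)) p) (<⇒≢ 2≤k)

  dominating : ∀ x → f x ≡ 0 → 2 ≤ nbrSum G f x
  dominating x fx≡0 with off fx≡0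
  ... | i , x≡ with cycSucc-exists i
  ...   | j , i→j = begin
    2                                     ≡⟨ cong₂ _+_ (one (inj₁ refl)) (one (inj₂ i→j)) ⟨
    h (from σ (inj₁ i)) + h (from σ (inj₁ j)) ≤⟨ two-terms≤sum h distinct ⟩
    sum h                                 ≡⟨ nbrSum≡sum G f x ⟨
    nbrSum G f x                          ∎
    where
    open ≤-Reasoning
    h : Fin n → ℕ
    h y = mask (adj G x y) (f y)
    one : ∀ {l} → i ≡ l ⊎ CycSucc k i l → h (from σ (inj₁ l)) ≡ 1
    one {l} c = trans (mask-true _ (nbr x≡ c)) (f-from (inj₁ l))
    distinct : from σ (inj₁ i) ≢ from σ (inj₁ j)
    distinct p = succ≢ i→j (inj₁-injective
      (trans (sym (strictlyInverseˡ σ (inj₁ i))) (trans (cong (to σ) p) (strictlyInverseˡ σ (inj₁ j)))))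

  independent : ∀ x y → f x ≡ 0 → f y ≡ 0 → adj G x y ≡ false
  independent x y fx fy = Bool.¬-not λ a → no-edge (off fx) (off fy) (proj₁ (adj⇔ x y) a)
    where
    no-edge : ∀ {a b} → (∃ λ i → a ≡ inj₂ i) → (∃ λ j → b ≡ inj₂ j) → ¬ Sym (OptEdge k e) a b
    no-edge (_ , refl) (_ , refl) (inj₁ ())
    no-edge (_ , refl) (_ , refl) (inj₂ ())

  -- The exchange of each vᵢ with uᵢ, carried over to `G`. It pairs every vertex of value 1 with one
  -- of value 0, whence `f` and `f ∘ to π` add up to 1 everywhere.
  π : Fin n ↔ Fin n
  π = ↔-trans σ (↔-trans (mk↔ₛ′ swap swap swap-involutive swap-involutive) (↔-sym σ))

  onCycle-swap : ∀ y → onCycle y + onCycle (swap y) ≡ 1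
  onCycle-swap (inj₁ _) = refl
  onCycle-swap (inj₂ _) = refl

  2w≡n : 2 * weight f ≡ n
  2w≡n = begin
    2 * weight f               ≡⟨ cong (2 *_) (weight≡sum f) ⟩
    2 * sum f                  ≡⟨ cong (sum f +_) (+-identityʳ (sum f)) ⟩
    sum f + sum f              ≡⟨ cong (sum f +_) (sum-permute f π) ⟩
    sum f + sum (f ∘ to π)     ≡⟨ ∑-distrib-+ f (f ∘ to π) ⟨
    sum (λ x → f x + f (to π x)) ≡⟨ sum-cong-≗ (λ x → trans (cong (f x +_) (f-from (swap (to σ x)))) (onCycle-swap (to σ x))) ⟩
    sum {n} (λ _ → 1)          ≡⟨ sum-const-1 n ⟩
    n                          ∎
    where open ≡-Reasoning

theorem8 : ∀ (n : ℕ) (G : Graph n) → 4 ≤ n → Connected G → ClawFree G →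
    ∀ (m : ℕ) → IsGammaCI G m → ((2 * m ≡ n) ⇔ InΩ G)
theorem8 n G 4≤n conn claw m ((f , cid , w≡m) , minimal) = mk⇔ ⇒ ⇐
  where
  ⇒ : 2 * m ≡ n → InΩ G
  ⇒ 2m≡n = alternating⇒Ω G (≤-trans (s≤s z≤n) 4≤n) conn
    (tight⇒alternating G claw f cid (trans (cong (2 *_) w≡m) 2m≡n))
  ⇐ : InΩ G → 2 * m ≡ n
  ⇐ ω with optSun⇒light-CID G (Ω⇒optSun G ω)
  -- Minimality against the light function `g` bounds `m` from above; the counting bound for the
  -- minimiser `f` bounds it from below.
  ... | g , g-cid , 2w≡n = ≤-antisym
    (≤-trans (*-monoʳ-≤ 2 (minimal g g-cid)) (≤-reflexive 2w≡n))
    (≤-trans (Counting.n≤2weight G claw f cid) (≤-reflexive (cong (2 *_) w≡m)))
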